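{- Let $S=[5]$, $T=[3]$, $$E_1=\{(1,1),(1,2),(2,1),(2,3),(3,2),(3,3),(4,1),(5,2)\},\qquad E_2=\{(2,2;3,1),\ (4,2;5,3)\},$$ and $G=(S,T,E_1\cup E_2)$. Then the associated doubly simple biquadratic form $$P_G(\mathbf{x},\mathbf{y})=\sum_{(i,j)\in E_1}x_i^2y_j^2+(x_2y_2+x_3y_1)^2+(x_4y_2+x_5y_3)^2$$ satisfies $\mathrm{SOS}(P_G)\le 9<10=|E_1|+|E_2|$. Hence this $5\times 3$ example is not irreducible. In particular, the local prohibition (W2') cannot be removed entirely: it is not true that every augmented bipartite graph satisfying (S), (W1), (W2) and (W3) has an irreducible associated form.
   Context: Notation: $[m]=\{1,\dots,m\}$. For an $m\times n$ biquadratic form $P(\mathbf{x},\mathbf{y})$ that is a finite sum of squares of real bilinear forms in $(\mathbf{x},\mathbf{y})$, $\mathrm{SOS}(P)$ (the SOS rank, also written $\operatorname{sos}(P)$) is the minimum number of squares in such a representation. Augmented bipartite graphs $G=(S,T,E_1\cup E_2)$, $S=[m]$, $T=[n]$. A cell is a pair $(i,j)\in[m]\times[n]$ ($i$ is its row, $j$ its column). A 1-edge is a cell; $E_1$ is a set of 1-edges, viewed as a bipartite graph $G_1$ on $S,T$. A 2-edge is an unordered pair of distinct cells, written $(i,j;k,l)$; the cells $(i,j)$ and $(k,l)$ are its two halves. It is nondegenerate if $i\ne k$ and $j\ne l$, row-degenerate if $i=k$ and $j\neq l$, column-degenerate if $i\ne k$ and $j=l$. $E_2$ is a set of 2-edges.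 The associated doubly simple biquadratic form is $P_G=\sum_{(i,j)\in E_1}x_i^2y_j^2+\sum_{(i,j;k,l)\in E_2}(x_iy_j+x_ky_l)^2$; it is called irreducible if $\mathrm{SOS}(P_G)=|E_1|+|E_2|$. A cell is occupied if it is in $E_1$ or is a half of some 2-edge in $E_2$; otherwise it is unoccupied. The opposite cells of a nondegenerate 2-edge $(i,j;k,l)$ are $(i,l)$ and $(k,j)$. Two nondegenerate 2-edges of the form $(i,j;k,l)$ and $(i,l;k,j)$ are called complementary. The dependency graph $\mathcal{D}$ is the directed graph whose vertices are the nondegenerate 2-edges in $E_2$, with an arc $e\to e'$ ($e\ne e'$) if both opposite cells of $e$ are occupied and one half of $e'$ is an opposite cell of $e$. An edge's row (column) set is the set of rows (columns) of its cell (1-edge) or of its halves (2-edge). Two edges are vertex-disjoint if their row sets are disjoint and their column sets are disjoint. The opposite cells of a vertex-disjoint pair $e,f$ are the cells formed by a row of one of the two edges and a column of the other. For a 1-edge $(i,j)$ and a 2-edge $(k,l;p,q)$ they are $(i,l),(i,q),(k,j),(p,j)$. Conditions: (S) No 2-edge shares a cell with any 1-edge or with any other 2-edge. (W1) $G_1$ contains no $C_4$. (W2) $\mathcal{D}$ contains no directed cycle other than 2-cycles formed by a pair of complementary 2-edges (which are allowed). (W2') There is no nondegenerate 2-edge in $E_2$ whose two opposite cells are both 1-edges. (W3) For every vertex-disjoint pair of edges of $G$ at least one of which is a 2-edge, at least one of the opposite cells of the pair is unoccupied. -}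

module Defs where

open import Algebra.Bundles using (CommutativeRing)
open import Algebra.Structures using (IsCommutativeRing)
open import Data.Fin.Base using (Fin)
open import Data.Fin.Patterns using (0F; 1F; 2F; 3F; 4F)
open import Data.List.Base using (List; []; _∷_; _++_; _∷ʳ_; map; foldr; length; cartesianProduct)
open import Data.List.Membership.Propositional using (_∈_; _∉_)
open import Data.List.Relation.Binary.Disjoint.Propositional using (Disjoint)
open import Data.List.Relation.Unary.AllPairs using (AllPairs; []; _∷_; allPairs?)
open import Data.List.Relation.Unary.All using ([]; _∷_)
open import Data.List.Relation.Unary.Linked using (Linked)
open import Data.List.Relation.Unary.Unique.Propositional using (Unique)
open import Data.Nat.Base as ℕ using (ℕ)
import Data.Nat.Properties as ℕ
open import Data.Product.Base using (_×_; _,_; ∃-syntax; Σ-syntax; proj₁; proj₂; swap)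
open import Data.Product.Properties using (≡-dec)
open import Data.Rational.Base as ℚ using (ℚ; 0ℚ; 1ℚ; ½; ∣_∣; 1/_)
import Data.Rational.Properties as ℚ
open import Data.Rational.Solver using (module +-*-Solver)
open import Data.Sum.Base using (_⊎_; inj₁; inj₂)
open import Data.Vec.Functional using (Vector)
import Data.Fin.Properties as Fin
open import Level using (0ℓ)
open import Relation.Binary.Core using (Rel)
open import Relation.Binary.PropositionalEquality
  using (_≡_; _≢_; refl; sym; trans; cong; cong₂; subst)
open import Relation.Nullary using (¬_)
open import Relation.Nullary.Decidable using (toWitness; ¬?)

------------------------------------------------------------------------
-- Real numbers: Cauchy sequences of rationals, with all operations taken
-- termwise and equality meaning that the difference tends to 0.

IsCauchy : (ℕ → ℚ) → Set
IsCauchy s = ∀ ε → 0ℚ ℚ.< ε →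
  ∃[ N ] (∀ m n → N ℕ.≤ m → N ℕ.≤ n → ∣ s m ℚ.- s n ∣ ℚ.< ε)

record ℝ : Set where
  no-eta-equality
  field
    seq    : ℕ → ℚ
    cauchy : IsCauchy seq

open ℝ

infix 4 _≈_

record _≈_ (x y : ℝ) : Set where
  no-eta-equality
  constructor mk≈
  field
    limit : ∀ ε → 0ℚ ℚ.< ε →
      ∃[ N ] (∀ n → N ℕ.≤ n → ∣ seq x n ℚ.- seq y n ∣ ℚ.< ε)

open _≈_

private
  module Lemmas where
    open ℚ.≤-Reasoning
    open +-*-Solver

    half-pos : ∀ ε → 0ℚ ℚ.< ε → 0ℚ ℚ.< ½ ℚ.* ε
    half-pos ε 0<ε = ℚ.positive⁻¹ _ {{ℚ.pos*pos⇒pos ½ ε {{ℚ.positive 0<ε}}}}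

    half-sum : ∀ ε → ½ ℚ.* ε ℚ.+ ½ ℚ.* ε ≡ ε
    half-sum ε = trans (sym (ℚ.*-distribʳ-+ ε ½ ½)) (ℚ.*-identityˡ ε)

    sum-bound : ∀ a b a′ b′ ε →
      ∣ a ℚ.- a′ ∣ ℚ.< ½ ℚ.* ε → ∣ b ℚ.- b′ ∣ ℚ.< ½ ℚ.* ε →
      ∣ (a ℚ.+ b) ℚ.- (a′ ℚ.+ b′) ∣ ℚ.< ε
    sum-bound a b a′ b′ ε p q = begin-strict
      ∣ (a ℚ.+ b) ℚ.- (a′ ℚ.+ b′) ∣
        ≡⟨ cong ∣_∣ (solve 4 (λ a b a′ b′ → (a :+ b) :- (a′ :+ b′) := (a :- a′) :+ (b :- b′)) refl a b a′ b′) ⟩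
      ∣ (a ℚ.- a′) ℚ.+ (b ℚ.- b′) ∣      ≤⟨ ℚ.∣p+q∣≤∣p∣+∣q∣ (a ℚ.- a′) (b ℚ.- b′) ⟩
      ∣ a ℚ.- a′ ∣ ℚ.+ ∣ b ℚ.- b′ ∣      <⟨ ℚ.+-mono-< p q ⟩
      ½ ℚ.* ε ℚ.+ ½ ℚ.* ε                ≡⟨ half-sum ε ⟩
      ε                                  ∎

    neg-diff : ∀ a b → ∣ (ℚ.- a) ℚ.- (ℚ.- b) ∣ ≡ ∣ a ℚ.- b ∣
    neg-diff a b = trans
      (cong ∣_∣ (solve 2 (λ a b → (:- a) :- (:- b) := :- (a :- b)) refl a b))
      (ℚ.∣-p∣≡∣p∣ (a ℚ.- b))

    sym-diff : ∀ a b → ∣ a ℚ.- b ∣ ≡ ∣ b ℚ.- a ∣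
    sym-diff a b = trans
      (cong ∣_∣ (solve 2 (λ a b → a :- b := :- (b :- a)) refl a b))
      (ℚ.∣-p∣≡∣p∣ (b ℚ.- a))

    trans-bound : ∀ a b c ε →
      ∣ a ℚ.- b ∣ ℚ.< ½ ℚ.* ε → ∣ b ℚ.- c ∣ ℚ.< ½ ℚ.* ε → ∣ a ℚ.- c ∣ ℚ.< ε
    trans-bound a b c ε p q = subst (λ z → ∣ z ∣ ℚ.< ε)
      (solve 3 (λ a b c → (a :+ b) :- (b :+ c) := a :- c) refl a b c)
      (sum-bound a b b c ε p q)

    self-diff : ∀ a b → a ≡ b → ∣ a ℚ.- b ∣ ≡ 0ℚ
    self-diff a .a refl = cong ∣_∣ (ℚ.+-inverseʳ a)

    bounded : ∀ s → IsCauchy s →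
      ∃[ A ] (0ℚ ℚ.< A × ∃[ N ] (∀ n → N ℕ.≤ n → ∣ s n ∣ ℚ.< A))
    bounded s c with c 1ℚ (ℚ.positive⁻¹ 1ℚ)
    ... | N , close = A , 0<A , N , λ n N≤n → begin-strict
        ∣ s n ∣                          ≡⟨ cong ∣_∣ (solve 2 (λ a b → a := (a :- b) :+ b) refl (s n) (s N)) ⟩
        ∣ (s n ℚ.- s N) ℚ.+ s N ∣        ≤⟨ ℚ.∣p+q∣≤∣p∣+∣q∣ (s n ℚ.- s N) (s N) ⟩
        ∣ s n ℚ.- s N ∣ ℚ.+ ∣ s N ∣      <⟨ ℚ.+-monoˡ-< ∣ s N ∣ (close n N N≤n ℕ.≤-refl) ⟩
        A                                ∎
      where
      A : ℚ
      A = 1ℚ ℚ.+ ∣ s N ∣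
      0<A : 0ℚ ℚ.< A
      0<A = ℚ.+-mono-<-≤ (ℚ.positive⁻¹ 1ℚ) (ℚ.0≤∣p∣ (s N))

    -- The precision δ to which factors bounded by A and B must be known
    -- for their product to be known to precision ε.
    module Product {A B ε : ℚ} (0<A : 0ℚ ℚ.< A) (0<B : 0ℚ ℚ.< B) (0<ε : 0ℚ ℚ.< ε) where
      instance
        A-pos : ℚ.Positive A
        A-pos = ℚ.positive 0<A
        B-pos : ℚ.Positive B
        B-pos = ℚ.positive 0<B
        ε-pos : ℚ.Positive ε
        ε-pos = ℚ.positive 0<ε
        A+B-pos : ℚ.Positive (A ℚ.+ B)
        A+B-pos = ℚ.pos+pos⇒pos A B
        A+B-nonZero : ℚ.NonZero (A ℚ.+ B)
        A+B-nonZero = ℚ.pos⇒nonZero (A ℚ.+ B)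
        1/-pos : ℚ.Positive (1/ (A ℚ.+ B))
        1/-pos = ℚ.1/pos⇒pos (A ℚ.+ B)

      δ : ℚ
      δ = 1/ (A ℚ.+ B) ℚ.* ε

      0<δ : 0ℚ ℚ.< δ
      0<δ = ℚ.positive⁻¹ δ {{ℚ.pos*pos⇒pos (1/ (A ℚ.+ B)) ε}}

      total : A ℚ.* δ ℚ.+ δ ℚ.* B ≡ ε
      total = begin-equality
        A ℚ.* δ ℚ.+ δ ℚ.* B                       ≡⟨ solve 3 (λ A B d → A :* d :+ d :* B := (A :+ B) :* d) refl A B δ ⟩
        (A ℚ.+ B) ℚ.* (1/ (A ℚ.+ B) ℚ.* ε)        ≡⟨ sym (ℚ.*-assoc (A ℚ.+ B) (1/ (A ℚ.+ B)) ε) ⟩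
        (A ℚ.+ B) ℚ.* 1/ (A ℚ.+ B) ℚ.* ε          ≡⟨ cong (ℚ._* ε) (ℚ.*-inverseʳ (A ℚ.+ B)) ⟩
        1ℚ ℚ.* ε                                  ≡⟨ ℚ.*-identityˡ ε ⟩
        ε                                         ∎

      scaled : ∀ {C p q} → 0ℚ ℚ.< C → 0ℚ ℚ.≤ q → p ℚ.< C → q ℚ.< δ → p ℚ.* q ℚ.< C ℚ.* δ
      scaled {C} {p} {q} 0<C 0≤q p<C q<δ = begin-strict
        p ℚ.* q  ≤⟨ ℚ.*-monoʳ-≤-nonNeg q {{ℚ.nonNegative 0≤q}} (ℚ.<⇒≤ p<C) ⟩
        C ℚ.* q  <⟨ ℚ.*-monoʳ-<-pos C {{ℚ.positive 0<C}} q<δ ⟩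
        C ℚ.* δ  ∎

      bound : ∀ a b a′ b′ → ∣ a ∣ ℚ.< A → ∣ b′ ∣ ℚ.< B →
        ∣ a ℚ.- a′ ∣ ℚ.< δ → ∣ b ℚ.- b′ ∣ ℚ.< δ →
        ∣ a ℚ.* b ℚ.- a′ ℚ.* b′ ∣ ℚ.< ε
      bound a b a′ b′ a<A b′<B da db = begin-strict
        ∣ a ℚ.* b ℚ.- a′ ℚ.* b′ ∣
          ≡⟨ cong ∣_∣ (solve 4 (λ a b a′ b′ → a :* b :- a′ :* b′ := a :* (b :- b′) :+ b′ :* (a :- a′)) refl a b a′ b′) ⟩
        ∣ a ℚ.* (b ℚ.- b′) ℚ.+ b′ ℚ.* (a ℚ.- a′) ∣
          ≤⟨ ℚ.∣p+q∣≤∣p∣+∣q∣ (a ℚ.* (b ℚ.- b′)) (b′ ℚ.* (a ℚ.- a′)) ⟩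
        ∣ a ℚ.* (b ℚ.- b′) ∣ ℚ.+ ∣ b′ ℚ.* (a ℚ.- a′) ∣
          ≡⟨ cong₂ ℚ._+_ (ℚ.∣p*q∣≡∣p∣*∣q∣ a (b ℚ.- b′)) (ℚ.∣p*q∣≡∣p∣*∣q∣ b′ (a ℚ.- a′)) ⟩
        ∣ a ∣ ℚ.* ∣ b ℚ.- b′ ∣ ℚ.+ ∣ b′ ∣ ℚ.* ∣ a ℚ.- a′ ∣
          <⟨ ℚ.+-mono-< (scaled 0<A (ℚ.0≤∣p∣ (b ℚ.- b′)) a<A db) (scaled 0<B (ℚ.0≤∣p∣ (a ℚ.- a′)) b′<B da) ⟩
        A ℚ.* δ ℚ.+ B ℚ.* δ
          ≡⟨ cong (A ℚ.* δ ℚ.+_) (ℚ.*-comm B δ) ⟩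
        A ℚ.* δ ℚ.+ δ ℚ.* B
          ≡⟨ total ⟩
        ε ∎

  open Lemmas

  left : ∀ {k m n} → m ℕ.⊔ n ℕ.≤ k → m ℕ.≤ k
  left {m = m} {n} = ℕ.m⊔n≤o⇒m≤o m n

  right : ∀ {k m n} → m ℕ.⊔ n ℕ.≤ k → n ℕ.≤ k
  right {m = m} {n} = ℕ.m⊔n≤o⇒n≤o m n

infixl 6 _+_
infixl 7 _*_
infix  8 -_

fromℚ : ℚ → ℝ
fromℚ q .seq _ = q
fromℚ q .cauchy ε 0<ε =
  0 , λ _ _ _ _ → subst (ℚ._< ε) (sym (self-diff q q refl)) 0<ε

0ℝ 1ℝ : ℝ
0ℝ = fromℚ 0ℚ
1ℝ = fromℚ 1ℚ

_+_ : ℝ → ℝ → ℝ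
(x + y) .seq n = seq x n ℚ.+ seq y n
(x + y) .cauchy ε 0<ε =
  let N₁ , p = cauchy x (½ ℚ.* ε) (half-pos ε 0<ε)
      N₂ , q = cauchy y (½ ℚ.* ε) (half-pos ε 0<ε)
  in N₁ ℕ.⊔ N₂ , λ m n ≤m ≤n →
       sum-bound (seq x m) (seq y m) (seq x n) (seq y n) ε
         (p m n (left ≤m) (left ≤n)) (q m n (right ≤m) (right ≤n))

-_ : ℝ → ℝ
(- x) .seq n = ℚ.- seq x n
(- x) .cauchy ε 0<ε =
  let N , p = cauchy x ε 0<ε
  in N , λ m n ≤m ≤n → subst (ℚ._< ε) (sym (neg-diff (seq x m) (seq x n))) (p m n ≤m ≤n)

_*_ : ℝ → ℝ → ℝ
(x * y) .seq n = seq x n ℚ.* seq y n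
(x * y) .cauchy ε 0<ε =
  let A , 0<A , M₁ , x<A = bounded (seq x) (cauchy x)
      B , 0<B , M₂ , y<B = bounded (seq y) (cauchy y)
      open Product 0<A 0<B 0<ε
      N₁ , p = cauchy x δ 0<δ
      N₂ , q = cauchy y δ 0<δ
  in (M₁ ℕ.⊔ M₂) ℕ.⊔ (N₁ ℕ.⊔ N₂) , λ m n ≤m ≤n →
       bound (seq x m) (seq y m) (seq x n) (seq y n)
         (x<A m (left (left ≤m))) (y<B n (right {m = M₁} (left ≤n)))
         (p m n (left (right {m = M₁ ℕ.⊔ M₂} ≤m)) (left (right {m = M₁ ℕ.⊔ M₂} ≤n)))
         (q m n (right {m = N₁} (right {m = M₁ ℕ.⊔ M₂} ≤m)) (right {m = N₁} (right {m = M₁ ℕ.⊔ M₂} ≤n)))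

termwise : ∀ {x y} → (∀ n → seq x n ≡ seq y n) → x ≈ y
termwise eq = mk≈ λ ε 0<ε →
  0 , λ n _ → subst (ℚ._< ε) (sym (self-diff _ _ (eq n))) 0<ε

≈-refl : ∀ {x} → x ≈ x
≈-refl = termwise λ _ → refl

≈-sym : ∀ {x y} → x ≈ y → y ≈ x
≈-sym {x} {y} x≈y = mk≈ λ ε 0<ε →
  let N , p = limit x≈y ε 0<ε
  in N , λ n ≤n → subst (ℚ._< ε) (sym-diff (seq x n) (seq y n)) (p n ≤n)

≈-trans : ∀ {x y z} → x ≈ y → y ≈ z → x ≈ z
≈-trans {x} {y} {z} x≈y y≈z = mk≈ λ ε 0<ε →
  let N₁ , p = limit x≈y (½ ℚ.* ε) (half-pos ε 0<ε)
      N₂ , q = limit y≈z (½ ℚ.* ε) (half-pos ε 0<ε)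
  in N₁ ℕ.⊔ N₂ , λ n ≤n →
       trans-bound (seq x n) (seq y n) (seq z n) ε (p n (left ≤n)) (q n (right ≤n))

+-cong : ∀ {x x′ y y′} → x ≈ x′ → y ≈ y′ → x + y ≈ x′ + y′
+-cong {x} {x′} {y} {y′} x≈x′ y≈y′ = mk≈ λ ε 0<ε →
  let N₁ , p = limit x≈x′ (½ ℚ.* ε) (half-pos ε 0<ε)
      N₂ , q = limit y≈y′ (½ ℚ.* ε) (half-pos ε 0<ε)
  in N₁ ℕ.⊔ N₂ , λ n ≤n →
       sum-bound (seq x n) (seq y n) (seq x′ n) (seq y′ n) ε (p n (left ≤n)) (q n (right ≤n))

neg-cong : ∀ {x x′} → x ≈ x′ → - x ≈ - x′
neg-cong {x} {x′} x≈x′ = mk≈ λ ε 0<ε →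
  let N , p = limit x≈x′ ε 0<ε
  in N , λ n ≤n → subst (ℚ._< ε) (sym (neg-diff (seq x n) (seq x′ n))) (p n ≤n)

*-cong : ∀ {x x′ y y′} → x ≈ x′ → y ≈ y′ → x * y ≈ x′ * y′
*-cong {x} {x′} {y} {y′} x≈x′ y≈y′ = mk≈ λ ε 0<ε →
  let A , 0<A , M₁ , x<A = bounded (seq x) (cauchy x)
      B , 0<B , M₂ , y′<B = bounded (seq y′) (cauchy y′)
      open Product 0<A 0<B 0<ε
      N₁ , p = limit x≈x′ δ 0<δ
      N₂ , q = limit y≈y′ δ 0<δ
  in (M₁ ℕ.⊔ M₂) ℕ.⊔ (N₁ ℕ.⊔ N₂) , λ n ≤n →
       bound (seq x n) (seq y n) (seq x′ n) (seq y′ n)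
         (x<A n (left (left ≤n))) (y′<B n (right {m = M₁} (left ≤n)))
         (p n (left (right {m = M₁ ℕ.⊔ M₂} ≤n)))
         (q n (right {m = N₁} (right {m = M₁ ℕ.⊔ M₂} ≤n)))

+-assoc : ∀ x y z → (x + y) + z ≈ x + (y + z)
+-assoc x y z = termwise λ n → ℚ.+-assoc (seq x n) (seq y n) (seq z n)

+-comm : ∀ x y → x + y ≈ y + x
+-comm x y = termwise λ n → ℚ.+-comm (seq x n) (seq y n)

+-identityˡ : ∀ x → 0ℝ + x ≈ x
+-identityˡ x = termwise λ n → ℚ.+-identityˡ (seq x n)

+-identityʳ : ∀ x → x + 0ℝ ≈ x
+-identityʳ x = termwise λ n → ℚ.+-identityʳ (seq x n)

+-inverseˡ : ∀ x → - x + x ≈ 0ℝ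
+-inverseˡ x = termwise λ n → ℚ.+-inverseˡ (seq x n)

+-inverseʳ : ∀ x → x + - x ≈ 0ℝ
+-inverseʳ x = termwise λ n → ℚ.+-inverseʳ (seq x n)

*-assoc : ∀ x y z → (x * y) * z ≈ x * (y * z)
*-assoc x y z = termwise λ n → ℚ.*-assoc (seq x n) (seq y n) (seq z n)

*-comm : ∀ x y → x * y ≈ y * x
*-comm x y = termwise λ n → ℚ.*-comm (seq x n) (seq y n)

*-identityˡ : ∀ x → 1ℝ * x ≈ x
*-identityˡ x = termwise λ n → ℚ.*-identityˡ (seq x n)

*-identityʳ : ∀ x → x * 1ℝ ≈ x
*-identityʳ x = termwise λ n → ℚ.*-identityʳ (seq x n)

distribˡ : ∀ x y z → x * (y + z) ≈ x * y + x * z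
distribˡ x y z = termwise λ n → ℚ.*-distribˡ-+ (seq x n) (seq y n) (seq z n)

distribʳ : ∀ x y z → (y + z) * x ≈ y * x + z * x
distribʳ x y z = termwise λ n → ℚ.*-distribʳ-+ (seq x n) (seq y n) (seq z n)

ℝ-isCommutativeRing : IsCommutativeRing _≈_ _+_ _*_ -_ 0ℝ 1ℝ
ℝ-isCommutativeRing = record
  { isRing = record
    { +-isAbelianGroup = record
      { isGroup = record
        { isMonoid = record
          { isSemigroup = record
            { isMagma = record
              { isEquivalence = record { refl = ≈-refl ; sym = ≈-sym ; trans = ≈-trans }
              ; ∙-cong        = +-cong
              }
            ; assoc = +-assoc
            }
          ; identity = +-identityˡ , +-identityʳ
          }
        ; inverse = +-inverseˡ , +-inverseʳ
        ; ⁻¹-cong = neg-cong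
        }
      ; comm = +-comm
      }
    ; *-cong     = *-cong
    ; *-assoc    = *-assoc
    ; *-identity = *-identityˡ , *-identityʳ
    ; distrib    = distribˡ , distribʳ
    }
  ; *-comm = *-comm
  }

ℝ-commutativeRing : CommutativeRing 0ℓ 0ℓ
ℝ-commutativeRing = record { isCommutativeRing = ℝ-isCommutativeRing }

open import Algebra.Properties.Semiring.Sum (CommutativeRing.semiring ℝ-commutativeRing)
  using (sum-syntax)

infix 9 _²

_² : ℝ → ℝ
x ² = x * x

------------------------------------------------------------------------
-- Sums of squares of bilinear forms

BilinearForm : ℕ → ℕ → Set
BilinearForm m n = Fin m → Fin n → ℝ

eval : ∀ {m n} → BilinearForm m n → Vector ℝ m → Vector ℝ n → ℝ
eval {m} {n} B x y = ∑[ i < m ] (∑[ j < n ] (B i j * (x i * y j)))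

-- Biquadratic forms are represented by the functions they induce; over
-- the infinite field ℝ the function determines the coefficients.
Form : ℕ → ℕ → Set
Form m n = Vector ℝ m → Vector ℝ n → ℝ

IsSumOfSquares : ∀ {m n} → Form m n → ℕ → Set
IsSumOfSquares {m} {n} P r =
  Σ[ B ∈ Vector (BilinearForm m n) r ] (∀ x y → P x y ≈ ∑[ k < r ] (eval (B k) x y ²))

IsSOSRank : ∀ {m n} → Form m n → ℕ → Set
IsSOSRank P r = IsSumOfSquares P r × (∀ s → IsSumOfSquares P s → r ℕ.≤ s)

-- SOS(P) ≤ k. The least element of an inhabited set of naturals exists
-- only up to double negation, so the bound is expressed both by a
-- representation with at most k squares and by the non-constructive
-- existence of a rank that is at most k.
SOSRankAtMost : ∀ {m n} → Form m n → ℕ → Set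
SOSRankAtMost P k =
  (∃[ s ] (IsSumOfSquares P s × s ℕ.≤ k)) × ¬ ¬ (∃[ r ] (IsSOSRank P r × r ℕ.≤ k))

------------------------------------------------------------------------
-- Augmented bipartite graphs

Cell : ℕ → ℕ → Set
Cell m n = Fin m × Fin n

-- The two halves are listed in some order; _≑_ below forgets it.
record TwoEdge (m n : ℕ) : Set where
  constructor _—_[_]
  field
    half₁ half₂ : Cell m n
    distinct    : half₁ ≢ half₂

open TwoEdge

module _ {m n : ℕ} where

  halves : TwoEdge m n → List (Cell m n)
  halves e = half₁ e ∷ half₂ e ∷ []

  oppositePair : TwoEdge m n → Cell m n × Cell m n
  oppositePair e = (proj₁ (half₁ e) , proj₂ (half₂ e)) , (proj₁ (half₂ e) , proj₂ (half₁ e))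

  opposites : TwoEdge m n → List (Cell m n)
  opposites e = proj₁ (oppositePair e) ∷ proj₂ (oppositePair e) ∷ []

  infix 4 _≐_ _≑_

  -- Equality of unordered pairs.
  _≐_ : Rel (Cell m n × Cell m n) 0ℓ
  p ≐ q = p ≡ q ⊎ swap p ≡ q

  _≑_ : Rel (TwoEdge m n) 0ℓ
  e ≑ f = (half₁ e , half₂ e) ≐ (half₁ f , half₂ f)

  Nondegenerate : TwoEdge m n → Set
  Nondegenerate e =
    proj₁ (half₁ e) ≢ proj₁ (half₂ e) × proj₂ (half₁ e) ≢ proj₂ (half₂ e)

  Complementary : Rel (TwoEdge m n) 0ℓ
  Complementary e f =
    Nondegenerate e × Nondegenerate f × oppositePair e ≐ (half₁ f , half₂ f)

record AugmentedBipartiteGraph (m n : ℕ) : Set where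
  field
    E₁        : List (Cell m n)
    E₂        : List (TwoEdge m n)
    E₁-unique : Unique E₁
    E₂-unique : AllPairs (λ e f → ¬ e ≑ f) E₂

module _ {m n : ℕ} (G : AugmentedBipartiteGraph m n) where

  open AugmentedBipartiteGraph G

  ∣E₁∣+∣E₂∣ : ℕ
  ∣E₁∣+∣E₂∣ = length E₁ ℕ.+ length E₂

  associatedForm : Form m n
  associatedForm x y =
    foldr _+_ 0ℝ (map (λ c → monomial c ²) E₁) +
    foldr _+_ 0ℝ (map (λ e → (monomial (half₁ e) + monomial (half₂ e)) ²) E₂)
    where
    monomial : Cell m n → ℝ
    monomial (i , j) = x i * y j

  Irreducible : Set
  Irreducible = IsSOSRank associatedForm ∣E₁∣+∣E₂∣

  Occupied : Cell m n → Set
  Occupied c = c ∈ E₁ ⊎ ∃[ e ] (e ∈ E₂ × c ∈ halves e)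

  Unoccupied : Cell m n → Set
  Unoccupied c = ¬ Occupied c

  -- Dependency graph

  IsVertex : TwoEdge m n → Set
  IsVertex e = e ∈ E₂ × Nondegenerate e

  Arc : Rel (TwoEdge m n) 0ℓ
  Arc e f =
    IsVertex e × IsVertex f × ¬ e ≑ f ×
    (∀ c → c ∈ opposites e → Occupied c) ×
    ∃[ c ] (c ∈ halves f × c ∈ opposites e)

  -- The cycle v → v₁ → … → vₖ → v with all of v, v₁, …, vₖ distinct.
  IsDirectedCycle : TwoEdge m n → List (TwoEdge m n) → Set
  IsDirectedCycle v vs =
    AllPairs (λ e f → ¬ e ≑ f) (v ∷ vs) × Linked Arc (v ∷ vs ∷ʳ v)

  -- Edges

  data Edge : Set where
    one : ∀ c → c ∈ E₁ → Edge
    two : ∀ e → e ∈ E₂ → Edge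

  data IsTwoEdge : Edge → Set where
    two : ∀ {e} (e∈E₂ : e ∈ E₂) → IsTwoEdge (two e e∈E₂)

  cells : Edge → List (Cell m n)
  cells (one c _) = c ∷ []
  cells (two e _) = halves e

  rows : Edge → List (Fin m)
  rows e = map proj₁ (cells e)

  columns : Edge → List (Fin n)
  columns e = map proj₂ (cells e)

  VertexDisjoint : Rel Edge 0ℓ
  VertexDisjoint e f = Disjoint (rows e) (rows f) × Disjoint (columns e) (columns f)

  oppositeCells : Edge → Edge → List (Cell m n)
  oppositeCells e f =
    cartesianProduct (rows e) (columns f) ++ cartesianProduct (rows f) (columns e)

  -- Conditions

  ConditionS : Set
  ConditionS =
    (∀ e → e ∈ E₂ → ∀ c → c ∈ E₁ → c ∉ halves e) ×
    (∀ e f → e ∈ E₂ → f ∈ E₂ → ¬ e ≑ f → Disjoint (halves e) (halves f))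

  -- A 4-cycle of G₁ visits two distinct rows and two distinct columns.
  ConditionW1 : Set
  ConditionW1 = ¬ (∃[ i ] ∃[ j ] ∃[ k ] ∃[ l ]
    (i ≢ k × j ≢ l × (i , j) ∈ E₁ × (k , j) ∈ E₁ × (k , l) ∈ E₁ × (i , l) ∈ E₁))

  ConditionW2 : Set
  ConditionW2 = ∀ v vs → IsDirectedCycle v vs → ∃[ w ] (vs ≡ w ∷ [] × Complementary v w)

  ConditionW3 : Set
  ConditionW3 = ∀ e f → VertexDisjoint e f → IsTwoEdge e ⊎ IsTwoEdge f →
    ∃[ c ] (c ∈ oppositeCells e f × Unoccupied c)

------------------------------------------------------------------------
-- The 5 × 3 example. Elements of Fin are numbered from 0, so the cell
-- (i , j) below is the pair (i + 1, j + 1) of [5] × [3].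

example : AugmentedBipartiteGraph 5 3
example = record
  { E₁ = (0F , 0F) ∷ (0F , 1F) ∷ (1F , 0F) ∷ (1F , 2F)
       ∷ (2F , 1F) ∷ (2F , 2F) ∷ (3F , 0F) ∷ (4F , 1F) ∷ []
  ; E₂ = ((1F , 1F) — (2F , 0F) [ (λ ()) ])
       ∷ ((3F , 1F) — (4F , 2F) [ (λ ()) ]) ∷ []
  ; E₁-unique = toWitness {a? = allPairs? (λ c d → ¬? (≡-dec Fin._≟_ Fin._≟_ c d)) _} _
  ; E₂-unique = ((λ { (inj₁ ()) ; (inj₂ ()) }) ∷ []) ∷ [] ∷ []
  }

{-# OPTIONS --safe #-}
-- Since x₂y₂ · x₃y₃ = x₂y₃ · x₃y₂ and x₂y₂ · x₃y₁ = x₂y₁ · x₃y₂, for every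
-- s with s² = 3/4 the five squares of P_G on the cells (2,1), (2,3), (3,2),
-- (3,3) and (2,2;3,1) collapse to four:
--
--   (x₃y₃ + s x₂y₂)² + (x₃y₁ + ½ x₂y₂)² + (x₂y₃ - s x₃y₂)² + (x₂y₁ + ½ x₃y₂)².
--
-- The graph violates only (W2'): its dependency graph has no arcs at all,
-- because the opposite cell (4,3) of (4,2;5,3) is unoccupied and (2,2;3,1)
-- depends on 1-edges only.
module Submission where

open import Defs
open import Algebra.Bundles using (CommutativeRing)
open import Data.Fin.Base using (Fin; zero; suc)
open import Data.Fin.Patterns using (0F; 1F; 2F; 3F; 4F)
import Data.Fin.Properties as Fin
import Data.Integer.Base as ℤ
open import Data.List.Base using (List; []; _∷_; _++_; map; concatMap; cartesianProduct; lookup)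
open import Data.List.Membership.Propositional using (_∈_; _∉_; find)
open import Data.List.Membership.Propositional.Properties using (∈-++⁺ˡ; ∈-++⁺ʳ; ∈-map⁺; ∈-concatMap⁺)
import Data.List.Membership.DecPropositional as DecMembership
open import Data.List.Relation.Binary.Disjoint.Propositional using (Disjoint)
import Data.List.Relation.Binary.Disjoint.DecPropositional as DecDisjoint
open import Data.List.Relation.Unary.All as All using (All; all?)
open import Data.List.Relation.Unary.Any as Any using (Any; here; there; any?)
open import Data.List.Relation.Unary.Linked using (_∷_)
open import Data.Nat.Base as ℕ using (ℕ; _<_; zero; suc; z≤n; s≤s)
open import Data.Nat.Induction using (<-rec)
import Data.Nat.Properties as ℕ
open import Data.Product.Base using (_×_; _,_; ∃-syntax; proj₁; proj₂)
open import Data.Product.Properties using (≡-dec)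
open import Data.Rational.Base as ℚ using (ℚ; mkℚ; 0ℚ; 1ℚ; ½; ∣_∣)
import Data.Rational.Properties as ℚ
open import Data.Rational.Solver using (module +-*-Solver)
import Data.Rational.Unnormalised.Base as ℚᵘ
import Data.Rational.Unnormalised.Properties as ℚᵘ
open import Data.Sum.Base using (_⊎_; inj₁; inj₂)
open import Data.Vec.Functional using (Vector)
open import Function.Base using (_∘_)
import Relation.Binary.Reasoning.Setoid as ≈-Reasoning
open import Relation.Binary.PropositionalEquality
  using (_≡_; refl; sym; trans; cong; cong₂)
open import Relation.Nullary using (¬_; contradiction; Dec)
open import Relation.Nullary.Decidable using (from-yes; from-no; ¬?; _×-dec_; _→-dec_)

open ℝ using (seq; cauchy)
open AugmentedBipartiteGraph using (E₁; E₂)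
open CommutativeRing ℝ-commutativeRing using (setoid; semiring; zeroˡ; +-congˡ; *-congˡ; *-congʳ)
open import Algebra.Definitions.RawSemiring ℚ.+-*-rawSemiring using (_^_)
open import Algebra.Properties.Semiring.Sum semiring
  using (sum-cong-≋; *-distribˡ-sum; *-distribʳ-sum; ∑-distrib-+; sum-replicate-zero; sum-syntax)

-- A real number with square 3/4

⅛ ¾ : ℚ
⅛ = ½ ℚ.* (½ ℚ.* ½)
¾ = ½ ℚ.+ ½ ℚ.* ½

-- Halving 1/(n+1) gives 1/(2n+2), which is at most 1/(n+2). Unnormalised fractions avoid any
-- reduction to lowest terms.
½^n≤1/[1+n] : ∀ n → ℚ.toℚᵘ (½ ^ n) ℚᵘ.≤ ℚᵘ.mkℚᵘ (ℤ.+ 1) n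
½^n≤1/[1+n] zero    = ℚᵘ.≤-refl
½^n≤1/[1+n] (suc n) = begin
  ℚ.toℚᵘ (½ ℚ.* ½ ^ n)                       ≃⟨ ℚ.toℚᵘ-homo-* ½ (½ ^ n) ⟩
  ℚ.toℚᵘ ½ ℚᵘ.* ℚ.toℚᵘ (½ ^ n)               ≤⟨ ℚᵘ.*-monoʳ-≤-nonNeg (ℚ.toℚᵘ ½) (½^n≤1/[1+n] n) ⟩
  ℚ.toℚᵘ ½ ℚᵘ.* ℚᵘ.mkℚᵘ (ℤ.+ 1) n            ≤⟨ ℚᵘ.*≤* (ℤ.+≤+ (s≤s (ℕ.+-monoˡ-≤ 0 (ℕ.≤-trans (ℕ.m≤m+n (suc n) 0) (ℕ.m≤n+m (suc n ℕ.+ 0) n))))) ⟩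
  ℚᵘ.mkℚᵘ (ℤ.+ 1) (suc n)                    ∎
  where open ℚᵘ.≤-Reasoning

½^n-small : ∀ ε → 0ℚ ℚ.< ε → ∃[ n ] ½ ^ n ℚ.< ε
½^n-small (mkℚ (ℤ.+ zero)  d c) (ℚ.*<* (ℤ.+<+ ()))
½^n-small (mkℚ ℤ.-[1+ a ]  d c) (ℚ.*<* ())
-- Here `d` is the denominator minus one, so `ε` is at least 1/(d+1); the exponent `suc d` gives the
-- strictly smaller bound 1/(d+2).
½^n-small ε@(mkℚ (ℤ.+ suc a) d c) 0<ε = suc d , ℚ.toℚᵘ-cancel-< (begin-strict
  ℚ.toℚᵘ (½ ^ suc d)        ≤⟨ ½^n≤1/[1+n] (suc d) ⟩
  ℚᵘ.mkℚᵘ (ℤ.+ 1) (suc d)   <⟨ ℚᵘ.*<* (ℤ.+<+ (s≤s (s≤s (ℕ.+-monoʳ-≤ d z≤n)))) ⟩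
  ℚ.toℚᵘ ε                  ∎)
  where open ℚᵘ.≤-Reasoning

module _ where
  open ℚ.≤-Reasoning
  open +-*-Solver

  -- 1 - t is a square root of 3/4 exactly when t = ½ t² + ⅛, and the right
  -- hand side is a contraction with factor ½ on [0 , ½].
  step : ℚ → ℚ
  step q = ½ ℚ.* (q ℚ.* q) ℚ.+ ⅛

  record Small (q : ℚ) : Set where
    constructor small
    field
      0≤ : 0ℚ ℚ.≤ q
      ≤½ : q ℚ.≤ ½

  -- `step` is increasing on nonnegative rationals, with value 1/8 at 0 and 1/4 at 1/2.
  step-small : ∀ {q} → Small q → Small (step q)
  step-small {q} (small 0≤q q≤½) = small
    (begin
      0ℚ                     ≤⟨ from-yes (0ℚ ℚ.≤? ⅛) ⟩
      ⅛                      ≡⟨ solve 1 (λ e → e := con ½ :* con 0ℚ :+ e) refl ⅛ ⟩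
      ½ ℚ.* 0ℚ ℚ.+ ⅛         ≡⟨ cong (λ z → ½ ℚ.* z ℚ.+ ⅛) (sym (ℚ.*-zeroʳ q)) ⟩
      ½ ℚ.* (q ℚ.* 0ℚ) ℚ.+ ⅛ ≤⟨ ℚ.+-monoˡ-≤ ⅛ (ℚ.*-monoˡ-≤-nonNeg ½ (ℚ.*-monoˡ-≤-nonNeg q 0≤q)) ⟩
      step q                 ∎)
    (begin
      step q                 ≤⟨ ℚ.+-monoˡ-≤ ⅛ (ℚ.*-monoˡ-≤-nonNeg ½ (ℚ.*-monoˡ-≤-nonNeg q q≤½)) ⟩
      ½ ℚ.* (q ℚ.* ½) ℚ.+ ⅛  ≤⟨ ℚ.+-monoˡ-≤ ⅛ (ℚ.*-monoˡ-≤-nonNeg ½ (ℚ.*-monoʳ-≤-nonNeg ½ q≤½)) ⟩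
      ½ ℚ.* (½ ℚ.* ½) ℚ.+ ⅛  ≤⟨ from-yes (½ ℚ.* (½ ℚ.* ½) ℚ.+ ⅛ ℚ.≤? ½) ⟩
      ½                      ∎)
    where instance _ = ℚ.nonNegative 0≤q

  -- The difference factors as ½ (p + q) (p - q), and p + q is at most 1.
  step-contracts : ∀ {p q} → Small p → Small q →
    ∣ step p ℚ.- step q ∣ ℚ.≤ ½ ℚ.* ∣ p ℚ.- q ∣
  step-contracts {p} {q} (small 0≤p p≤½) (small 0≤q q≤½) = begin
    ∣ step p ℚ.- step q ∣
      ≡⟨ cong ∣_∣ (solve 3 (λ p q e →
           (con ½ :* (p :* p) :+ e) :- (con ½ :* (q :* q) :+ e) :=
           con ½ :* ((p :+ q) :* (p :- q))) refl p q ⅛) ⟩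
    ∣ ½ ℚ.* ((p ℚ.+ q) ℚ.* (p ℚ.- q)) ∣
      ≡⟨ trans (ℚ.∣p*q∣≡∣p∣*∣q∣ ½ ((p ℚ.+ q) ℚ.* (p ℚ.- q))) (cong (½ ℚ.*_) (ℚ.∣p*q∣≡∣p∣*∣q∣ (p ℚ.+ q) (p ℚ.- q))) ⟩
    ½ ℚ.* (∣ p ℚ.+ q ∣ ℚ.* ∣ p ℚ.- q ∣)
      ≡⟨ cong (λ z → ½ ℚ.* (z ℚ.* ∣ p ℚ.- q ∣)) (ℚ.0≤p⇒∣p∣≡p (ℚ.+-mono-≤ 0≤p 0≤q)) ⟩
    ½ ℚ.* ((p ℚ.+ q) ℚ.* ∣ p ℚ.- q ∣)
      ≤⟨ ℚ.*-monoˡ-≤-nonNeg ½ (ℚ.*-monoʳ-≤-nonNeg ∣ p ℚ.- q ∣ (ℚ.+-mono-≤ p≤½ q≤½)) ⟩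
    ½ ℚ.* (1ℚ ℚ.* ∣ p ℚ.- q ∣)
      ≡⟨ cong (½ ℚ.*_) (ℚ.*-identityˡ ∣ p ℚ.- q ∣) ⟩
    ½ ℚ.* ∣ p ℚ.- q ∣ ∎
    where instance _ = ℚ.nonNegative (ℚ.0≤∣p∣ (p ℚ.- q))

  iterate-step : ℕ → ℚ
  iterate-step zero    = 0ℚ
  iterate-step (suc n) = step (iterate-step n)

  iterate-step-small : ∀ n → Small (iterate-step n)
  iterate-step-small zero    = small ℚ.≤-refl (from-yes (0ℚ ℚ.≤? ½))
  iterate-step-small (suc n) = step-small (iterate-step-small n)

  small-diff : ∀ {p q} → Small p → Small q → ∣ p ℚ.- q ∣ ℚ.≤ 1ℚ
  small-diff {p} {q} (small 0≤p p≤½) (small 0≤q q≤½) = begin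
    ∣ p ℚ.- q ∣        ≤⟨ ℚ.∣p-q∣≤∣p∣+∣q∣ p q ⟩
    ∣ p ∣ ℚ.+ ∣ q ∣    ≡⟨ cong₂ ℚ._+_ (ℚ.0≤p⇒∣p∣≡p 0≤p) (ℚ.0≤p⇒∣p∣≡p 0≤q) ⟩
    p ℚ.+ q            ≤⟨ ℚ.+-mono-≤ p≤½ q≤½ ⟩
    1ℚ                 ∎

  -- Removing one `step` from both iterates gains a factor ½. After `N` removals the crude bound 1 =
  -- ½ ^ 0 remains.
  iterate-step-close : ∀ N {m n} → N ℕ.≤ m → N ℕ.≤ n →
    ∣ iterate-step m ℚ.- iterate-step n ∣ ℚ.≤ ½ ^ N
  iterate-step-close zero {m} {n} _ _ = small-diff (iterate-step-small m) (iterate-step-small n)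
  iterate-step-close (suc N) {suc m} {suc n} (s≤s N≤m) (s≤s N≤n) = begin
    ∣ step (iterate-step m) ℚ.- step (iterate-step n) ∣
      ≤⟨ step-contracts (iterate-step-small m) (iterate-step-small n) ⟩
    ½ ℚ.* ∣ iterate-step m ℚ.- iterate-step n ∣
      ≤⟨ ℚ.*-monoˡ-≤-nonNeg ½ (iterate-step-close N N≤m N≤n) ⟩
    ½ ℚ.* ½ ^ N ∎

  fixedPoint : ℝ
  fixedPoint .seq = iterate-step
  fixedPoint .cauchy ε 0<ε =
    let N , ½^N<ε = ½^n-small ε 0<ε
    in N , λ m n N≤m N≤n → ℚ.≤-<-trans (iterate-step-close N N≤m N≤n) ½^N<ε

  -- The right-hand sequence at index n is `iterate-step (suc n)` by definition, so the claim
  -- compares consecutive iterates.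
  fixedPoint-fixed : fixedPoint ≈ fromℚ ½ * (fixedPoint * fixedPoint) + fromℚ ⅛
  fixedPoint-fixed = mk≈ λ ε 0<ε →
    let N , ½^N<ε = ½^n-small ε 0<ε
    in N , λ n N≤n → ℚ.≤-<-trans (iterate-step-close N N≤n (ℕ.m≤n⇒m≤1+n N≤n)) ½^N<ε

  √¾ : ℝ
  √¾ = 1ℝ + - fixedPoint

  -- With t for `fixedPoint`, (1 - t)² = ¾ + 2 ((½ t² + ⅛) - t) holds termwise, and the fixed-point
  -- equation makes the outer bracket vanish.
  √¾²≈¾ : √¾ ² ≈ fromℚ ¾
  √¾²≈¾ = ≈-trans
    (termwise λ n → solve 1 (λ t →
      (con 1ℚ :+ :- t) :* (con 1ℚ :+ :- t) :=
      con ¾ :+ con (½ ℚ.+ ½ ℚ.+ ½ ℚ.+ ½) :* ((con ½ :* (t :* t) :+ con ⅛) :+ :- t)) refl (iterate-step n))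
    (≈-trans
      (+-cong {fromℚ ¾} ≈-refl (*-cong {fromℚ (½ ℚ.+ ½ ℚ.+ ½ ℚ.+ ½)} ≈-refl (+-cong {y = - fixedPoint} (≈-sym fixedPoint-fixed) ≈-refl)))
      (termwise λ n → solve 1 (λ t →
        con ¾ :+ con (½ ℚ.+ ½ ℚ.+ ½ ℚ.+ ½) :* (t :+ :- t) := con ¾) refl (iterate-step n)))

-- Sparse bilinear forms

δ : ∀ {n} → Fin n → Vector ℝ n
δ zero    zero    = 1ℝ
δ zero    (suc _) = 0ℝ
δ (suc _) zero    = 0ℝ
δ (suc i) (suc j) = δ i j

sum-δ : ∀ {n} (i : Fin n) (x : Vector ℝ n) → ∑[ k < n ] (δ i k * x k) ≈ x i
sum-δ {suc n} zero x = begin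
  1ℝ * x zero + ∑[ k < n ] (0ℝ * x (suc k)) ≈⟨ +-cong (*-identityˡ (x zero)) (sum-cong-≋ λ k → zeroˡ (x (suc k))) ⟩
  x zero + ∑[ k < n ] 0ℝ                    ≈⟨ +-congˡ (sum-replicate-zero n) ⟩
  x zero + 0ℝ                               ≈⟨ +-identityʳ (x zero) ⟩
  x zero                                    ∎
  where open ≈-Reasoning setoid
sum-δ {suc n} (suc i) x = begin
  0ℝ * x zero + ∑[ k < n ] (δ i k * x (suc k)) ≈⟨ +-cong (zeroˡ (x zero)) (sum-δ i (x ∘ suc)) ⟩
  0ℝ + x (suc i)                               ≈⟨ +-identityˡ (x (suc i)) ⟩
  x (suc i)                                    ∎
  where open ≈-Reasoning setoid

module _ {m n : ℕ} where
  open ≈-Reasoning setoid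

  Terms : Set
  Terms = List (ℝ × Cell m n)

  bilinear : Terms → BilinearForm m n
  bilinear []                 k l = 0ℝ
  bilinear ((a , i , j) ∷ ts) k l = a * (δ i k * δ j l) + bilinear ts k l

  evalTerms : Terms → Vector ℝ m → Vector ℝ n → ℝ
  evalTerms []                 x y = 0ℝ
  evalTerms ((a , i , j) ∷ ts) x y = a * (x i * y j) + evalTerms ts x y

  eval-0 : ∀ x y → eval (λ (_ : Fin m) (_ : Fin n) → 0ℝ) x y ≈ 0ℝ
  eval-0 x y = begin
    ∑[ k < m ] (∑[ l < n ] (0ℝ * (x k * y l))) ≈⟨ sum-cong-≋ (λ k → sum-cong-≋ λ l → zeroˡ (x k * y l)) ⟩
    ∑[ k < m ] (∑[ l < n ] 0ℝ)                 ≈⟨ sum-cong-≋ {m} (λ k → sum-replicate-zero n) ⟩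
    ∑[ k < m ] 0ℝ                              ≈⟨ sum-replicate-zero m ⟩
    0ℝ                                         ∎

  eval-+ : ∀ (B C : BilinearForm m n) x y →
    eval (λ k l → B k l + C k l) x y ≈ eval B x y + eval C x y
  eval-+ B C x y = begin
    ∑[ k < m ] (∑[ l < n ] ((B k l + C k l) * (x k * y l)))
      ≈⟨ sum-cong-≋ (λ k → sum-cong-≋ λ l → distribʳ (x k * y l) (B k l) (C k l)) ⟩
    ∑[ k < m ] (∑[ l < n ] (B k l * (x k * y l) + C k l * (x k * y l)))
      ≈⟨ sum-cong-≋ (λ k → ∑-distrib-+ (λ l → B k l * (x k * y l)) (λ l → C k l * (x k * y l))) ⟩
    ∑[ k < m ] (∑[ l < n ] (B k l * (x k * y l)) + ∑[ l < n ] (C k l * (x k * y l)))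
      ≈⟨ ∑-distrib-+ (λ k → ∑[ l < n ] (B k l * (x k * y l))) (λ k → ∑[ l < n ] (C k l * (x k * y l))) ⟩
    eval B x y + eval C x y ∎

  -- The double sum factors into two single sums, each of which `sum-δ` collapses to one entry.
  eval-δ : ∀ a i j x y → eval (λ k l → a * (δ i k * δ j l)) x y ≈ a * (x i * y j)
  eval-δ a i j x y = begin
    ∑[ k < m ] (∑[ l < n ] (a * (δ i k * δ j l) * (x k * y l)))
      ≈⟨ sum-cong-≋ (λ k → sum-cong-≋ λ l → regroup a (δ i k) (δ j l) (x k) (y l)) ⟩
    ∑[ k < m ] (∑[ l < n ] (a * (δ i k * x k) * (δ j l * y l)))
      ≈⟨ sum-cong-≋ (λ k → *-distribˡ-sum (a * (δ i k * x k)) (λ l → δ j l * y l)) ⟨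
    ∑[ k < m ] (a * (δ i k * x k) * ∑[ l < n ] (δ j l * y l))
      ≈⟨ sum-cong-≋ (λ k → *-congˡ {a * (δ i k * x k)} (sum-δ j y)) ⟩
    ∑[ k < m ] (a * (δ i k * x k) * y j)
      ≈⟨ *-distribʳ-sum (y j) (λ k → a * (δ i k * x k)) ⟨
    ∑[ k < m ] (a * (δ i k * x k)) * y j
      ≈⟨ *-congʳ (*-distribˡ-sum a (λ k → δ i k * x k)) ⟨
    a * ∑[ k < m ] (δ i k * x k) * y j
      ≈⟨ *-congʳ (*-congˡ {a} (sum-δ i x)) ⟩
    a * x i * y j
      ≈⟨ *-assoc a (x i) (y j) ⟩
    a * (x i * y j) ∎
    where
    regroup : ∀ a b c d e → a * (b * c) * (d * e) ≈ a * (b * d) * (c * e)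
    regroup a b c d e = termwise λ n →
      solve 5 (λ a b c d e → a :* (b :* c) :* (d :* e) := a :* (b :* d) :* (c :* e)) refl
        (seq a n) (seq b n) (seq c n) (seq d n) (seq e n)
      where open +-*-Solver

  -- This trades the double sum over all cells for a short polynomial that the ring solver can
  -- treat.
  eval-bilinear : ∀ ts x y → eval (bilinear ts) x y ≈ evalTerms ts x y
  eval-bilinear []                   x y = eval-0 x y
  eval-bilinear ((a , i , j) ∷ ts) x y = begin
    eval (bilinear ((a , i , j) ∷ ts)) x y
      ≈⟨ eval-+ (λ k l → a * (δ i k * δ j l)) (bilinear ts) x y ⟩
    eval (λ k l → a * (δ i k * δ j l)) x y + eval (bilinear ts) x y
      ≈⟨ +-cong (eval-δ a i j x y) (eval-bilinear ts x y) ⟩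
    a * (x i * y j) + evalTerms ts x y ∎

-- The representation with nine squares

nine : List (Terms {5} {3})
nine = ((1ℝ , 0F , 0F) ∷ [])
     ∷ ((1ℝ , 0F , 1F) ∷ [])
     ∷ ((1ℝ , 3F , 0F) ∷ [])
     ∷ ((1ℝ , 4F , 1F) ∷ [])
     ∷ ((1ℝ , 3F , 1F) ∷ (1ℝ , 4F , 2F) ∷ [])
     -- The five squares so far are kept from the form; the next four replace five. The cross terms
     -- with `√¾` and `- √¾` cancel, the two with ½ add up to that of the 2-edge (2,2;3,1), and ¾ +
     -- ¼ = 1 restores the squares of x₂y₂ and x₃y₂.
     ∷ ((1ℝ , 2F , 2F) ∷ (√¾ , 1F , 1F) ∷ [])
     ∷ ((1ℝ , 2F , 0F) ∷ (fromℚ ½ , 1F , 1F) ∷ [])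
     ∷ ((1ℝ , 1F , 2F) ∷ (- √¾ , 2F , 1F) ∷ [])
     ∷ ((1ℝ , 1F , 0F) ∷ (fromℚ ½ , 2F , 1F) ∷ [])
     ∷ []

-- The solver works termwise over ℚ, where the square of `√¾` is not exactly ¾. So a multiple of ¾ -
-- ¾ is inserted, its first ¾ is replaced by `√¾ ²`, and what remains is a polynomial identity in s;
-- `excess` is the coefficient of s².
nine-squares : ∀ x y → associatedForm example x y ≈ ∑[ k < 9 ] (evalTerms (lookup nine k) x y ²)
nine-squares x y = begin
  associatedForm example x y
    ≈⟨ termwise (λ n → solve 9 (λ x₁ x₂ x₃ x₄ x₅ y₁ y₂ y₃ s →
         form x₁ x₂ x₃ x₄ x₅ y₁ y₂ y₃ :=
         form x₁ x₂ x₃ x₄ x₅ y₁ y₂ y₃ :+ excess x₂ x₃ y₂ :* (con ¾ :+ :- con ¾))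
         refl (X 0F n) (X 1F n) (X 2F n) (X 3F n) (X 4F n) (Y 0F n) (Y 1F n) (Y 2F n) (seq √¾ n)) ⟩
  associatedForm example x y + ((x 1F * y 1F) ² + (x 2F * y 1F) ²) * (fromℚ ¾ + - fromℚ ¾)
    ≈⟨ +-congˡ {associatedForm example x y} (*-congˡ {(x 1F * y 1F) ² + (x 2F * y 1F) ²}
         (+-cong {y = - fromℚ ¾} (≈-sym √¾²≈¾) ≈-refl)) ⟩
  associatedForm example x y + ((x 1F * y 1F) ² + (x 2F * y 1F) ²) * (√¾ ² + - fromℚ ¾)
    ≈⟨ termwise (λ n → solve 9 (λ x₁ x₂ x₃ x₄ x₅ y₁ y₂ y₃ s →
         form x₁ x₂ x₃ x₄ x₅ y₁ y₂ y₃ :+ excess x₂ x₃ y₂ :* (sq s :+ :- con ¾) :=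
         sq (monomial x₁ y₁) :+ (sq (monomial x₁ y₂) :+ (sq (monomial x₄ y₁) :+ (sq (monomial x₅ y₂) :+
         (sq (binomial x₄ y₂ (con 1ℚ) x₅ y₃) :+ (sq (binomial x₃ y₃ s x₂ y₂) :+ (sq (binomial x₃ y₁ (con ½) x₂ y₂) :+
         (sq (binomial x₂ y₃ (:- s) x₃ y₂) :+ (sq (binomial x₂ y₁ (con ½) x₃ y₂) :+ con 0ℚ)))))))))
         refl (X 0F n) (X 1F n) (X 2F n) (X 3F n) (X 4F n) (Y 0F n) (Y 1F n) (Y 2F n) (seq √¾ n)) ⟩
  ∑[ k < 9 ] (evalTerms (lookup nine k) x y ²) ∎
  where
  open ≈-Reasoning setoid
  open +-*-Solver
  X : Fin 5 → ℕ → ℚ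
  X i = seq (x i)
  Y : Fin 3 → ℕ → ℚ
  Y j = seq (y j)
  -- These polynomials copy the unfolded sums literally, with unit coefficients and trailing zeros,
  -- so that their values match the terms of the sequences definitionally.
  module _ {k : ℕ} where
    sq : Polynomial k → Polynomial k
    sq p = p :* p
    monomial : (p q : Polynomial k) → Polynomial k
    monomial p q = con 1ℚ :* (p :* q) :+ con 0ℚ
    binomial : (p q c p′ q′ : Polynomial k) → Polynomial k
    binomial p q c p′ q′ = con 1ℚ :* (p :* q) :+ (c :* (p′ :* q′) :+ con 0ℚ)
    excess : (x₂ x₃ y₂ : Polynomial k) → Polynomial k
    excess x₂ x₃ y₂ = sq (x₂ :* y₂) :+ sq (x₃ :* y₂)
    form : (x₁ x₂ x₃ x₄ x₅ y₁ y₂ y₃ : Polynomial k) → Polynomial k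
    form x₁ x₂ x₃ x₄ x₅ y₁ y₂ y₃ =
      (sq (x₁ :* y₁) :+ (sq (x₁ :* y₂) :+ (sq (x₂ :* y₁) :+ (sq (x₂ :* y₃) :+
      (sq (x₃ :* y₂) :+ (sq (x₃ :* y₃) :+ (sq (x₄ :* y₁) :+ (sq (x₅ :* y₂) :+ con 0ℚ)))))))) :+
      (sq (x₂ :* y₂ :+ x₃ :* y₁) :+ (sq (x₄ :* y₂ :+ x₅ :* y₃) :+ con 0ℚ))

example-sumOfSquares : IsSumOfSquares (associatedForm example) 9
example-sumOfSquares = (λ k → bilinear (lookup nine k)) , λ x y → begin
  associatedForm example x y
    ≈⟨ nine-squares x y ⟩
  ∑[ k < 9 ] (evalTerms (lookup nine k) x y ²)
    ≈⟨ sum-cong-≋ (λ k → *-cong (eval-bilinear (lookup nine k) x y) (eval-bilinear (lookup nine k) x y)) ⟨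
  ∑[ k < 9 ] (eval (bilinear (lookup nine k)) x y ²) ∎
  where open ≈-Reasoning setoid

-- From a representation to the rank bound and reducibility

-- Strong induction on `s`: if no least element exists, then no t below `s` satisfies `P`, which
-- makes `s` itself least.
¬¬-least : ∀ {p} (P : ℕ → Set p) s → P s →
  ¬ ¬ (∃[ r ] ((P r × (∀ t → P t → r ℕ.≤ t)) × r ℕ.≤ s))
¬¬-least P = <-rec _ λ s smaller Ps none → none
  (s , (Ps , λ t Pt → ℕ.≮⇒≥ λ t<s → smaller t<s Pt
    λ (r , least , r≤t) → none (r , least , ℕ.≤-trans r≤t (ℕ.<⇒≤ t<s))) , ℕ.≤-refl)

sumOfSquares⇒SOSRankAtMost : ∀ {m n} {P : Form m n} {k} → IsSumOfSquares P k → SOSRankAtMost P k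
sumOfSquares⇒SOSRankAtMost {P = P} {k} sos = (k , sos , ℕ.≤-refl) , ¬¬-least (IsSumOfSquares P) k sos

example-reducible : ¬ Irreducible example
example-reducible (_ , minimal) = from-no (10 ℕ.≤? 9) (minimal 9 example-sumOfSquares)

-- The conditions on the example

infix 4 _≟ᶜ_

_≟ᶜ_ : (c d : Cell 5 3) → Dec (c ≡ d)
_≟ᶜ_ = ≡-dec Fin._≟_ Fin._≟_

open DecMembership _≟ᶜ_ using (_∈?_; _∉?_)
open DecDisjoint _≟ᶜ_ using (disjoint?)

conditionS : ConditionS example
conditionS = (λ e e∈E₂ c c∈E₁ → All.lookup (All.lookup apart e∈E₂) c∈E₁) , disjoint
  where
  apart : All (λ e → All (λ c → c ∉ halves e) (E₁ example)) (E₂ example)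
  apart = from-yes (all? (λ e → all? (λ c → c ∉? halves e) (E₁ example)) (E₂ example))

  disjoint : ∀ e f → e ∈ E₂ example → f ∈ E₂ example → ¬ e ≑ f → Disjoint (halves e) (halves f)
  disjoint e f (here refl)         (here refl)         e≢f = contradiction (inj₁ refl) e≢f
  disjoint e f (here refl)         (there (here refl)) _   = from-yes (disjoint? (halves e) (halves f))
  disjoint e f (there (here refl)) (here refl)         _   = from-yes (disjoint? (halves e) (halves f))
  disjoint e f (there (here refl)) (there (here refl)) e≢f = contradiction (inj₁ refl) e≢f

conditionW1 : ConditionW1 example
conditionW1 = from-no
  (Fin.any? λ i → Fin.any? λ j → Fin.any? λ k → Fin.any? λ l →
    ¬? (i Fin.≟ k) ×-dec ¬? (j Fin.≟ l) ×-dec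
    (i , j) ∈? E₁ example ×-dec (k , j) ∈? E₁ example ×-dec
    (k , l) ∈? E₁ example ×-dec (i , l) ∈? E₁ example)

-- The opposite cells (2,1), (3,2), (4,3), (5,2) include no half of a 2-edge.
no-arc : ∀ e f → ¬ Arc example e f
no-arc e f ((e∈E₂ , _) , (f∈E₂ , _) , _ , _ , c , c∈halves , c∈opposites) =
  All.lookup (All.lookup independent e∈E₂) f∈E₂ (c∈opposites , c∈halves)
  where
  independent : All (λ e → All (λ f → Disjoint (opposites e) (halves f)) (E₂ example)) (E₂ example)
  independent = from-yes (all? (λ e → all? (λ f → disjoint? (opposites e) (halves f)) (E₂ example)) (E₂ example))

-- Every cycle starts with an arc, a loop at `v` when `vs` is empty, so the condition holds
-- vacuously.
conditionW2 : ConditionW2 example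
conditionW2 v []       (_ , arc ∷ _) = contradiction arc (no-arc v v)
conditionW2 v (w ∷ ws) (_ , arc ∷ _) = contradiction arc (no-arc v w)

-- Listing the cells makes membership decidable; a cell outside the list is unoccupied.
occupied : List (Cell 5 3)
occupied = E₁ example ++ concatMap halves (E₂ example)

Occupied⇒∈occupied : ∀ {c} → Occupied example c → c ∈ occupied
Occupied⇒∈occupied (inj₁ c∈E₁)            = ∈-++⁺ˡ c∈E₁
Occupied⇒∈occupied (inj₂ (e , e∈E₂ , c∈e)) =
  ∈-++⁺ʳ (E₁ example) (∈-concatMap⁺ halves (Any.map (λ { refl → c∈e }) e∈E₂))

-- Vertex-disjointness and opposite cells depend only on the cells of an edge, so (W3) can be
-- checked on these lists without membership proofs.
singles pairs edges : List (List (Cell 5 3))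
singles = map (_∷ []) (E₁ example)
pairs   = map halves (E₂ example)
edges   = singles ++ pairs

cells∈edges : ∀ e → cells example e ∈ edges
cells∈edges (one c c∈E₁) = ∈-++⁺ˡ (∈-map⁺ (_∷ []) c∈E₁)
cells∈edges (two e e∈E₂) = ∈-++⁺ʳ singles (∈-map⁺ halves e∈E₂)

cells∈pairs : ∀ {e} → IsTwoEdge example e → cells example e ∈ pairs
cells∈pairs (two e∈E₂) = ∈-map⁺ halves e∈E₂

NotBlocked : (as bs : List (Cell 5 3)) → Set
NotBlocked as bs =
  Disjoint (map proj₁ as) (map proj₁ bs) × Disjoint (map proj₂ as) (map proj₂ bs) →
  Any (_∉ occupied) (cartesianProduct (map proj₁ as) (map proj₂ bs) ++
                     cartesianProduct (map proj₁ bs) (map proj₂ as))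

notBlocked? : ∀ as bs → Dec (NotBlocked as bs)
notBlocked? as bs =
  (Rows.disjoint? (map proj₁ as) (map proj₁ bs) ×-dec Columns.disjoint? (map proj₂ as) (map proj₂ bs))
  →-dec any? (_∉? occupied) _
  where
  module Rows    = DecDisjoint (Fin._≟_ {5})
  module Columns = DecDisjoint (Fin._≟_ {3})

conditionW3 : ConditionW3 example
conditionW3 e f disjoint twoEdge =
  let c , c∈opposite , c∉occupied = find (notBlocked twoEdge disjoint)
  in c , c∈opposite , c∉occupied ∘ Occupied⇒∈occupied
  where
  -- Either member of the pair may be the 2-edge, so both orders are checked.
  pairs-edges : All (λ as → All (NotBlocked as) edges) pairs
  pairs-edges = from-yes (all? (λ as → all? (notBlocked? as) edges) pairs)

  edges-pairs : All (λ as → All (NotBlocked as) pairs) edges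
  edges-pairs = from-yes (all? (λ as → all? (notBlocked? as) pairs) edges)

  notBlocked : IsTwoEdge example e ⊎ IsTwoEdge example f → NotBlocked (cells example e) (cells example f)
  notBlocked (inj₁ e-two) = All.lookup (All.lookup pairs-edges (cells∈pairs e-two)) (cells∈edges f)
  notBlocked (inj₂ f-two) = All.lookup (All.lookup edges-pairs (cells∈edges e)) (cells∈pairs f-two)

proposition20 : SOSRankAtMost (associatedForm example) 9
    × 9 < 10
    × 10 ≡ ∣E₁∣+∣E₂∣ example
    × ¬ Irreducible example
    × ¬ ((m n : ℕ) (G : AugmentedBipartiteGraph m n) →
    ConditionS G → ConditionW1 G → ConditionW2 G → ConditionW3 G → Irreducible G)
proposition20 =
  sumOfSquares⇒SOSRankAtMost example-sumOfSquares ,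
  ℕ.n<1+n 9 ,
  refl ,
  example-reducible ,
  λ irreducible → example-reducible
    (irreducible 5 3 example conditionS conditionW1 conditionW2 conditionW3)
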